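{- A permutation $\pi$ avoids $\xi$ if and only if each block in the first-element decomposition of $\pi$ is increasing.
   Context: Permutations $\pi=\pi_1\cdots\pi_n$ of $\{1,\dots,n\}$, $n\ge1$, are written in one-line notation. $\xi=(132,\{0,2\},\emptyset)$ is a bivincular pattern: $\pi$ contains $\xi$ if there is an index $j\ge 2$ with $j+1\le n$ such that $\pi_1<\pi_{j+1}<\pi_j$ (that is, $\pi_1\pi_j\pi_{j+1}$ is an occurrence of $132$ starting at the first entry of $\pi$ and whose last two entries are adjacent in position); otherwise $\pi$ avoids $\xi$. First-element decomposition: let $\pi_1=t+1$ with $t\ge 0$. Write $\pi=\pi_1 B_0 b_1 B_1 b_2 B_2\cdots b_t B_t$, where $b_1,\dots,b_t$ are the entries of $\pi$ smaller than $\pi_1$, listed in order of appearance from left to right (so $\{b_1,\dots,b_t\}=\{1,\dots,t\}$), $B_0$ is the (possibly empty) sequence of entries between $\pi_1$ and $b_1$, $B_i$ for $1\le i<t$ is the (possibly empty) sequence of entries between $b_i$ and $b_{i+1}$, and $B_t$ is the (possibly empty) sequence of entries after $b_t$ (if $t=0$, $B_0$ consists of all entries after $\pi_1$). The sequences $B_0,\dots,B_t$ are the blocks. A block is increasing if its entries increase from left to right (an empty block is increasing). -}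

module Defs where

import Algebra.Properties.CommutativeMonoid.Sum
open import Data.Bool.Base using (if_then_else_)
open import Data.Fin.Base using (Fin; zero; suc; toℕ)
open import Data.Fin.Permutation using (Permutation′; _⟨$⟩ʳ_)
open import Data.Fin.Properties using (toℕ<n)
open import Data.List.Base using (List; []; _∷_; _++_; tabulate)
open import Data.List.Relation.Unary.All using ([]; _∷_) renaming (All to AllList)
open import Data.List.Relation.Unary.Linked using (Linked)
open import Data.Nat.Base using (ℕ; zero; suc; _+_; _≤_; _<_; _≮_; z≤n; s≤s)
open import Data.Nat.Properties using (_<?_; +-0-commutativeMonoid; <-irrefl; <⇒≤)
open import Data.Product.Base using (∃₂; _×_)
open import Data.Vec.Base using (Vec; []; _∷_)
open import Data.Vec.Relation.Unary.All using (All; []; _∷_)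
open import Function.Base using (_∘_)
open import Relation.Binary.PropositionalEquality
  using (_≡_; refl; trans; cong; module ≡-Reasoning)
open import Relation.Nullary using (¬_; Dec; does; yes; no)
open import Relation.Nullary.Decidable using (dec-false)

-- A permutation of {1,…,n} with n = suc m is a bijection on Fin n.  Positions
-- and values of Fin count from 0; `entry` shifts the value, so that
-- `entry π i` is π_{i+1} ∈ {1,…,n}.
entry : ∀ {m} → Permutation′ (suc m) → Fin (suc m) → ℕ
entry π i = suc (toℕ (π ⟨$⟩ʳ i))

oneLine : ∀ {m} → Permutation′ (suc m) → List ℕ
oneLine π = tabulate (entry π)

-- ξ = (132, {0,2}, ∅): the occurrence starts at the first position, and its
-- last two positions j, k are adjacent.  0 < toℕ j is the 1-based j ≥ 2.
Contains-ξ : ∀ {m} → Permutation′ (suc m) → Set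
Contains-ξ {m} π = ∃₂ λ (j k : Fin (suc m)) →
  0 < toℕ j × toℕ k ≡ suc (toℕ j) ×
  entry π zero < entry π k × entry π k < entry π j

Avoids-ξ : ∀ {m} → Permutation′ (suc m) → Set
Avoids-ξ π = ¬ Contains-ξ π

-- B₀ b₁ B₁ b₂ B₂ ⋯ b_t B_t
interleave : ∀ {t} → Vec (List ℕ) (suc t) → Vec ℕ t → List ℕ
interleave (B ∷ _)  []       = B
interleave (B ∷ Bs) (b ∷ bs) = B ++ b ∷ interleave Bs bs

-- separators = b₁ ⋯ b_t and blocks = B₀ ⋯ B_t.  By the last two fields the
-- separators are exactly the entries smaller than π₁; together with `word`
-- this determines the decomposition.
record FirstElementDecomposition {m} (π : Permutation′ (suc m)) : Set where
  field
    t           : ℕ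
    first       : entry π zero ≡ suc t
    separators  : Vec ℕ t
    blocks      : Vec (List ℕ) (suc t)
    word        : oneLine π ≡ entry π zero ∷ interleave blocks separators
    small       : All (_< entry π zero) separators
    notSmall    : All (AllList (_≮ entry π zero)) blocks

Increasing : List ℕ → Set
Increasing = Linked _<_

private
  open Algebra.Properties.CommutativeMonoid.Sum +-0-commutativeMonoid
    using (sum; sum-permute)

  indicator : ℕ → ℕ → ℕ
  indicator p x = if does (x <? p) then 1 else 0

  count : ℕ → List ℕ → ℕ
  count p []       = 0
  count p (x ∷ xs) = indicator p x + count p xs

  record Split (p : ℕ) (xs : List ℕ) (t : ℕ) : Set where
    field
      bs    : Vec ℕ t
      Bs    : Vec (List ℕ) (suc t)
      eq    : xs ≡ interleave Bs bs
      small : All (_< p) bs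
      large : All (AllList (_≮ p)) Bs

  extend : ∀ {t} x (B : List ℕ) (Bs : Vec (List ℕ) t) (bs : Vec ℕ t) →
           x ∷ interleave (B ∷ Bs) bs ≡ interleave ((x ∷ B) ∷ Bs) bs
  extend x B _ []      = refl
  extend x B _ (_ ∷ _) = refl

  splitCons : ∀ {p x xs t} (x<?p : Dec (x < p)) → Split p xs t →
              Split p (x ∷ xs) ((if does x<?p then 1 else 0) + t)
  splitCons {x = x} (yes x<p) s = record
    { bs    = x ∷ bs
    ; Bs    = [] ∷ Bs
    ; eq    = cong (x ∷_) eq
    ; small = x<p ∷ small
    ; large = [] ∷ large
    }
    where open Split s
  splitCons {x = x} (no x≮p)
    record { bs = bs ; Bs = B ∷ Bs ; eq = eq ; small = small ; large = B≮ ∷ Bs≮ } = record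
    { bs    = bs
    ; Bs    = (x ∷ B) ∷ Bs
    ; eq    = trans (cong (x ∷_) eq) (extend x B Bs bs)
    ; small = small
    ; large = (x≮p ∷ B≮) ∷ Bs≮
    }

  split : ∀ p xs → Split p xs (count p xs)
  split p [] = record
    { bs = [] ; Bs = [] ∷ [] ; eq = refl ; small = [] ; large = [] ∷ [] }
  split p (x ∷ xs) = splitCons (x <? p) (split p xs)

  count-tabulate : ∀ p {n} (f : Fin n → ℕ) →
                   count p (tabulate f) ≡ sum (indicator p ∘ f)
  count-tabulate p {zero}  f = refl
  count-tabulate p {suc n} f =
    cong (indicator p (f zero) +_) (count-tabulate p (f ∘ suc))

  sum-below : ∀ {n p} → p ≤ n → sum {n} (indicator p ∘ toℕ) ≡ p
  sum-below {zero}  z≤n       = refl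
  sum-below {suc n} z≤n       = sum-below {n} z≤n
  sum-below {suc n} (s≤s p≤n) = cong suc (sum-below p≤n)

  count-self : ∀ p xs → count p (p ∷ xs) ≡ count p xs
  count-self p xs = cong (λ b → (if b then 1 else 0) + count p xs)
                         (dec-false (p <? p) (<-irrefl refl))

  count-smaller : ∀ {m} (π : Permutation′ (suc m)) →
    toℕ (π ⟨$⟩ʳ zero) ≡ count (entry π zero) (tabulate (entry π ∘ suc))
  count-smaller {m} π = begin
    q
      ≡⟨ sum-below (<⇒≤ (toℕ<n (π ⟨$⟩ʳ zero))) ⟨
    sum {suc m} (indicator q ∘ toℕ)
      ≡⟨ sum-permute {suc m} (indicator q ∘ toℕ) π ⟩
    sum {suc m} (indicator (suc q) ∘ entry π)
      ≡⟨ count-tabulate (suc q) (entry π) ⟨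
    count (suc q) (oneLine π)
      ≡⟨ count-self (suc q) (tabulate (entry π ∘ suc)) ⟩
    count (suc q) (tabulate (entry π ∘ suc))
      ∎
    where
    open ≡-Reasoning
    q = toℕ (π ⟨$⟩ʳ zero)

decompose : ∀ {m} (π : Permutation′ (suc m)) → FirstElementDecomposition π
decompose π = record
  { t          = _
  ; first      = cong suc (count-smaller π)
  ; separators = bs
  ; blocks     = Bs
  ; word       = cong (entry π zero ∷_) eq
  ; small      = small
  ; notSmall   = large
  }
  where open Split (split (entry π zero) (tabulate (entry π ∘ suc)))

{-# OPTIONS --safe #-}
-- For y following x in the tail of π, call the step x, y good when
-- y ≮ π₁ implies x < y.  As the entries are distinct, π avoids ξ iff all steps
-- of the tail are good.  A step into or out of an entry smaller than π₁ is
-- always good, and a step inside a block is good iff it is an ascent.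
module Submission where

open import Defs
open import Data.Fin.Base using (Fin; zero; suc; toℕ)
open import Data.Fin.Properties using (toℕ-injective)
open import Data.List.Base using (List; []; _∷_; _++_; tabulate)
open import Data.List.Properties using (∷-injectiveʳ)
open import Data.List.Relation.Unary.All using ([]; _∷_) renaming (All to AllList)
open import Data.List.Relation.Unary.Linked as Linked using (Linked; []; [-]; _∷_)
open import Data.Nat.Base using (ℕ; suc; _<_; _≮_; s≤s; z≤n)
open import Data.Nat.Properties
  using (≮⇒≥; ≤∧≢⇒<; <-≤-trans; <-asym; <⇒≯; suc-injective; 1+n≢n)
open import Data.Fin.Permutation using (Permutation′; _⟨$⟩ʳ_)
open import Data.Product.Base using (_×_; _,_)
open import Data.Vec.Base using (Vec; []; _∷_)
open import Data.Vec.Relation.Unary.All using (All; []; _∷_)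
open import Function.Base using (_∘_)
open import Function.Bundles using (_⇔_; mk⇔; Equivalence; Injection)
open import Function.Properties.Inverse using (↔⇒↣)
open import Level using (Level)
open import Relation.Binary.Core using (Rel)
open import Relation.Binary.PropositionalEquality
  using (_≡_; _≢_; refl; sym; trans; cong; subst)
open import Relation.Nullary using (contradiction)

private
  variable
    a ℓ : Level
    A : Set a
    R : Rel A ℓ
    p : ℕ

-- Adjacency is phrased through `toℕ`, as in `Contains-ξ`, so that chains and occurrences of ξ
-- translate directly.
tabulate-Linked⁺ : ∀ {n} {f : Fin n → A} →
  (∀ i j → toℕ j ≡ suc (toℕ i) → R (f i) (f j)) → Linked R (tabulate f)
tabulate-Linked⁺ {n = 0}           r = []
tabulate-Linked⁺ {n = 1}           r = [-]
tabulate-Linked⁺ {n = suc (suc n)} r =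
  r zero (suc zero) refl ∷ tabulate-Linked⁺ λ i j eq → r (suc i) (suc j) (cong suc eq)

tabulate-Linked⁻ : ∀ {n} {f : Fin n → A} → Linked R (tabulate f) →
  ∀ i j → toℕ j ≡ suc (toℕ i) → R (f i) (f j)
tabulate-Linked⁻ {n = suc (suc n)} (r ∷ _)  zero    (suc zero) _  = r
tabulate-Linked⁻ {n = suc (suc n)} (_ ∷ rs) (suc i) (suc j)    eq =
  tabulate-Linked⁻ rs i j (suc-injective eq)

∷-Linked⁺ : ∀ {x : A} {xs} → (∀ y → R x y) → Linked R xs → Linked R (x ∷ xs)
∷-Linked⁺ {xs = []}    r rs = [-]
∷-Linked⁺ {xs = y ∷ _} r rs = r y ∷ rs

-- Asking for `R x y` at every `x` avoids locating the last entry of `xs`; a separator `y` satisfies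
-- this for `Good p`.
++∷-Linked⁺ : ∀ {xs : List A} {y ys} → (∀ x → R x y) →
  Linked R xs → Linked R (y ∷ ys) → Linked R (xs ++ y ∷ ys)
++∷-Linked⁺               r []       ss = ss
++∷-Linked⁺ {xs = x ∷ []} r [-]      ss = r x ∷ ss
++∷-Linked⁺               r (s ∷ rs) ss = s ∷ ++∷-Linked⁺ r rs ss

++-Linked⁻ : ∀ (xs : List A) {ys} → Linked R (xs ++ ys) → Linked R xs × Linked R ys
++-Linked⁻ []           rs       = [] , rs
++-Linked⁻ (x ∷ [])     rs       = [-] , Linked.tail rs
++-Linked⁻ (x ∷ y ∷ xs) (r ∷ rs) with ++-Linked⁻ (y ∷ xs) rs
... | rs₁ , rs₂ = r ∷ rs₁ , rs₂

-- A step fails exactly when `p ≤ y ≤ x`; for distinct entries and `p` = π₁ these are the last two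
-- entries of an occurrence of ξ.
Good : ℕ → Rel ℕ _
Good p x y = y ≮ p → x < y

Good⇒Increasing : ∀ {B} → AllList (_≮ p) B → Linked (Good p) B → Increasing B
Good⇒Increasing _              []       = []
Good⇒Increasing _              [-]      = [-]
Good⇒Increasing (_ ∷ y≮p ∷ ≮p) (g ∷ gs) = g y≮p ∷ Good⇒Increasing (y≮p ∷ ≮p) gs

Increasing⇒Good : ∀ {B} → Increasing B → Linked (Good p) B
Increasing⇒Good = Linked.map λ x<y _ → x<y

-- Cutting the chain before each separator and dropping the separator leaves a chain on each block,
-- where every step is an ascent.
interleave-Good⁻ : ∀ {t} (Bs : Vec (List ℕ) (suc t)) (bs : Vec ℕ t) →
  All (AllList (_≮ p)) Bs → Linked (Good p) (interleave Bs bs) → All Increasing Bs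
interleave-Good⁻ (B ∷ []) []       (B≮p ∷ [])   gs = Good⇒Increasing B≮p gs ∷ []
interleave-Good⁻ (B ∷ Bs) (b ∷ bs) (B≮p ∷ Bs≮p) gs with ++-Linked⁻ B gs
... | gs₁ , gs₂ =
  Good⇒Increasing B≮p gs₁ ∷ interleave-Good⁻ Bs bs Bs≮p (Linked.tail gs₂)

interleave-Good⁺ : ∀ {t} (Bs : Vec (List ℕ) (suc t)) (bs : Vec ℕ t) →
  All (_< p) bs → All Increasing Bs → Linked (Good p) (interleave Bs bs)
interleave-Good⁺ (B ∷ []) []       []           (inc ∷ [])   = Increasing⇒Good inc
interleave-Good⁺ (B ∷ Bs) (b ∷ bs) (b<p ∷ bs<p) (inc ∷ incs) =
  -- The step into `b` is vacuously good; the step out of `b` ascends because `b < p ≤ y`.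
  ++∷-Linked⁺ (λ _ b≮p → contradiction b<p b≮p) (Increasing⇒Good inc)
    (∷-Linked⁺ (λ _ y≮p → <-≤-trans b<p (≮⇒≥ y≮p)) (interleave-Good⁺ Bs bs bs<p incs))

module _ {m} (π : Permutation′ (suc m)) where

  private
    π₁ = entry π zero

  entry-injective : ∀ {i j} → entry π i ≡ entry π j → i ≡ j
  entry-injective = Injection.injective (↔⇒↣ π) ∘ toℕ-injective ∘ suc-injective

  Avoids-ξ⇔Good : Avoids-ξ π ⇔ Linked (Good π₁) (tabulate (entry π ∘ suc))
  Avoids-ξ⇔Good = mk⇔ (λ avoids → tabulate-Linked⁺ (good avoids)) avoid
    where
    good : Avoids-ξ π → ∀ i j → toℕ j ≡ suc (toℕ i) →
           Good π₁ (entry π (suc i)) (entry π (suc j))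
    good avoids i j j≡1+i y≮π₁ = ≤∧≢⇒< (≮⇒≥ y≮x) x≢y
      where
      y≮x : entry π (suc j) ≮ entry π (suc i)
      -- A descent to `y ≥ π₁` would complete an occurrence; π₁ differs from `y` since position
      -- `zero` is not `suc j`.
      y≮x y<x = avoids (suc i , suc j , s≤s z≤n , cong suc j≡1+i ,
        ≤∧≢⇒< (≮⇒≥ y≮π₁) (λ eq → contradiction (entry-injective eq) λ ()) , y<x)

      x≢y : entry π (suc i) ≢ entry π (suc j)
      -- Equal entries would sit at equal positions, but `j` is the successor of `i`.
      x≢y eq = 1+n≢n (trans (sym j≡1+i) (sym (suc-injective (cong toℕ (entry-injective eq)))))

    avoid : Linked (Good π₁) (tabulate (entry π ∘ suc)) → Avoids-ξ π
    -- Both positions are successors: the first is positive and the second exceeds it, so the pair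
    -- is a step of the tail.
    avoid gs (suc i , suc j , _ , eq , π₁<y , y<x) =
      <-asym y<x (tabulate-Linked⁻ gs i j (suc-injective eq) (<⇒≯ π₁<y))

  -- The argument works from the fields of `d` alone: `notSmall` serves the forward direction and
  -- `small` the converse.
  Avoids-ξ⇔Increasing : (d : FirstElementDecomposition π) →
    Avoids-ξ π ⇔ All Increasing (FirstElementDecomposition.blocks d)
  Avoids-ξ⇔Increasing d = mk⇔
    (interleave-Good⁻ blocks separators notSmall ∘ subst (Linked _) tail-word ∘ to)
    (from ∘ subst (Linked _) (sym tail-word) ∘ interleave-Good⁺ blocks separators small)
    where
    open FirstElementDecomposition d
    open Equivalence Avoids-ξ⇔Good

    tail-word : tabulate (entry π ∘ suc) ≡ interleave blocks separators
    tail-word = ∷-injectiveʳ word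

lemma3 : ∀ {m : ℕ} (π : Permutation′ (suc m)) →
    Avoids-ξ π ⇔ All Increasing (FirstElementDecomposition.blocks (decompose π))
lemma3 π = Avoids-ξ⇔Increasing π (decompose π)
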